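{- (i) Each of the axiom schemes $\mathtt{mp}$, $\mathtt{minimp}$, $\mathtt{peirce}$, $\mathtt{contrap}$, $\mathtt{notelim}$, $\mathtt{gen}$, $\mathtt{ALLdistr}$, $\mathtt{vacGen}$, $\mathtt{EQrefl}$, $\mathtt{denot}$, $\mathtt{subst}$ and $\mathtt{modal5}$ is independent in $\mathtt{TMM}$; that is, none of these schemes $\Phi$ is provable from $\mathtt{TMM}\setminus\{\Phi\}$. (ii) Each of the axiom schemes $\mathtt{EQsymm}$ and $\mathtt{EQtrans}$ is independent in $\mathtt{TMM}\setminus\{\mathtt{subst},\mathtt{ALLeq}\}$ and is independent in $\mathtt{TMM}\setminus\{\mathtt{denot}\}$.
   Context: **Metavariables and metaformulas.** Let $\mathrm{vrMV}=\{x_i\mid i\in\omega\}$ (variable metavariables) and $\mathrm{fmMV}=\{\phi_i\mid i\in\omega\}$ (formula metavariables) be disjoint countably infinite sets of symbols, and $\mathrm{MV}=\mathrm{vrMV}\cup\mathrm{fmMV}$. A language $\mathcal L$ is a set of further symbols (nonlogical predicates) with an arity function $\mathcal L\to\omega$. Fix a language $\mathcal L$. A metaformula is one of: a formula metavariable; $x_i\equiv x_j$; $P(x_{i_1},\dots,x_{i_r})$ with $P\in\mathcal L$ of arity $r$; $\forall x_i\,\Phi$; $\neg\Phi$; $\Phi\to\Psi$, where $\Phi,\Psi$ are metaformulas. $\mathrm{MF}$ is the set of metaformulas. $\mathrm{OC}(\Phi)\subseteq\mathrm{MV}$ is the set of metavariables occurring in $\Phi$ (including those directly after a quantifier), and $\mathrm{OC}(x_i)=\{x_i\}$.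 For a set $X$, $\mathcal P_2(X)$ is the set of its two-element subsets. **Schemes.** A scheme $\Phi=(\{\Phi_1,\dots,\Phi_n\},\Phi_0,\mathrm{DV}(\Phi))$ consists of a finite set of metaformulas (hypotheses), a metaformula (conclusion), and a set $\mathrm{DV}(\Phi)\subseteq\mathcal P_2(\mathrm{OC}(\Phi))$ (disjoint variable conditions), where $\mathrm{OC}(\Phi)$ is the set of metavariables occurring in its hypotheses or conclusion. Writing $(\Phi_I,\Phi_0,D)$ with a larger $D$ means that $D$ is intersected with $\mathcal P_2(\mathrm{OC}(\Phi))$. Such a scheme is displayed as $\Phi_1\;\&\;\dots\;\&\;\Phi_n\Longrightarrow\Phi_0,\ \mathrm{DV}(\cdot,\cdot),\dots$, where $\mathrm{DV}(m,n)$ denotes the condition $\{m,n\}$. **Substitution and instances.** A substitution is a map $\sigma:\mathrm{MV}\to\mathrm{vrMV}\cup\mathrm{MF}$ with $\sigma(\mathrm{vrMV})\subseteq\mathrm{vrMV}$, $\sigma(\mathrm{fmMV})\subseteq\mathrm{MF}$ and $\sigma(m)=m$ for all but finitely many $m$. $\Phi^\sigma$ is the result of simultaneous plain substitution in the metaformula $\Phi$ (variable metavariables after quantifiers are also replaced). For $D\subseteq\mathcal P_2(\mathrm{MV})$, $D^\sigma=\{\{m,n\}\in\mathcal P_2(\mathrm{MV})\mid\exists\{m',n'\}\in D,\ m\in\mathrm{OC}(\sigma(m')),\ n\in\mathrm{OC}(\sigma(n'))\}$. $\sigma$ is legitimate on a scheme $\Phi$ if $\{m,n\}\in\mathrm{DV}(\Phi)$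 implies $\mathrm{OC}(\sigma(m))\cap\mathrm{OC}(\sigma(n))=\varnothing$. A scheme $\Psi$ is an instance of $\Phi$ if for some $\sigma$ legitimate on $\Phi$ the hypotheses and conclusion of $\Psi$ are the images under $\sigma$ of those of $\Phi$ and $\mathrm{DV}(\Phi)^\sigma\subseteq\mathrm{DV}(\Psi)$. **Proofs.** A proof of a scheme $\Phi$ from a set of schemes $S$ is a finite sequence $P$ of metaformulas (lines) whose last line is the conclusion of $\Phi$ and such that each line $P_i$ that is not a hypothesis of $\Phi$ admits $i_1,\dots,i_n<i$ for which $(\{P_{i_1},\dots,P_{i_n}\},P_i,\mathrm{DV}(P))$ is an instance of a scheme in $S$, where $\mathrm{DV}(P)=\mathrm{DV}(\Phi)\cup\{\{m,n\}\mid m\in\mathrm{OC}(P)\setminus\mathrm{OC}(\Phi),\ n\in\mathrm{OC}(P),\ m\ne n\}$ and $\mathrm{OC}(P)$ is the set of metavariables occurring in the lines of $P$ (or in $\Phi$). $\Phi$ is provable from $S$ if such a proof exists. A scheme is independent in a set of schemes containing it if it is not provable from the other schemes of that set. (Provability does not depend on the choice of the language containing the symbols involved.) **The system $\mathtt{TMM}$.** With $x,y,z$ distinct variable metavariables and $\phi,\psi,\chi,\theta,\tau$ distinct formula metavariables, $\mathtt{TMM}$ is the set of the following schemes: - $\mathtt{mp}$: $\phi\;\&\;\phi\to\psi\Longrightarrow\psi$ - $\mathtt{minimp}$: $\phi\to((\psi\to\chi)\to(((\theta\to\psi)\to(\chi\to\tau))\to(\psi\to\tau)))$ - $\mathtt{peirce}$: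 $((\phi\to\psi)\to\phi)\to\phi$ - $\mathtt{contrap}$: $(\phi\to\neg\psi)\to(\psi\to\neg\phi)$ - $\mathtt{notelim}$: $\neg\phi\to(\phi\to\psi)$ - $\mathtt{gen}$: $\phi\Longrightarrow\forall x\,\phi$ - $\mathtt{ALLdistr}$: $\forall x(\phi\to\psi)\to(\forall x\,\phi\to\forall x\,\psi)$ - $\mathtt{spec}$: $\forall x\,\phi\to\phi$ - $\mathtt{modal5}$: $\neg\forall x\,\phi\to\forall x\,\neg\forall x\,\phi$ - $\mathtt{vacGen}$: $\phi\to\forall x\,\phi,\ \mathrm{DV}(x,\phi)$ - $\mathtt{ALLcomm}$: $\forall x\forall y\,\phi\to\forall y\forall x\,\phi$ - $\mathtt{EQrefl}$: $x\equiv x$ - $\mathtt{EQsymm}$: $x\equiv y\to y\equiv x$ - $\mathtt{EQtrans}$: $x\equiv y\to(y\equiv z\to x\equiv z)$ - $\mathtt{denot}$: $x\equiv x\to\neg\forall y\,\neg\,y\equiv x,\ \mathrm{DV}(x,y)$ - $\mathtt{subst}$: $\forall x(x\equiv y\to(\phi\to\forall x(x\equiv y\to\phi))),\ \mathrm{DV}(x,y),\ \mathrm{DV}(y,\phi)$ - $\mathtt{ALLeq}$: $\forall x\,x\equiv y\to(\forall x\,\phi\to\forall y\,\phi)$ - $\mathtt{genEq}$: $\neg\forall x\,x\equiv y\to(\neg\forall x\,x\equiv z\to(y\equiv z\to\forall x\,y\equiv z))$ -}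

module Defs where

open import Level using (0ℓ)
open import Data.Nat using (ℕ; suc)
open import Data.Fin using (Fin; fromℕ; _<_)
open import Data.Vec as Vec using (Vec; lookup; toList)
open import Data.List using (List; []; _∷_; [_]; _++_; map; concatMap)
open import Data.List.Membership.Propositional using (_∈_; _∉_)
open import Data.List.Relation.Unary.All using (All)
open import Data.List.Relation.Binary.Disjoint.Propositional using (Disjoint)
open import Data.List.Relation.Binary.BagAndSetEquality using (_∼[_]_; set)
open import Data.Product using (_×_; _,_; ∃-syntax)
open import Data.Sum using (_⊎_; inj₁; inj₂; swap)
open import Relation.Binary.Core using (Rel)
open import Relation.Binary.Definitions using (Symmetric)
open import Relation.Binary.PropositionalEquality using (_≡_; _≢_; sym)
open import Relation.Nullary using (¬_)
open import Relation.Unary using (Pred; ｛_｝; _∖_)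

data vrMV : Set where
  vr : ℕ → vrMV

data fmMV : Set where
  fm : ℕ → fmMV

MV : Set
MV = vrMV ⊎ fmMV

-- A set of two-element subsets of MV, that is, a subset of 𝒫₂(MV):
-- `D ∋｛ m , n ｝` reads {m,n} ∈ D.
record PairSet : Set₁ where
  field
    _∋｛_,_｝ : Rel MV 0ℓ
    symmetric : Symmetric _∋｛_,_｝
    distinct  : ∀ {m n} → _∋｛_,_｝ m n → m ≢ n

open PairSet public using (_∋｛_,_｝)

-- The set { {m,n} ∈ 𝒫₂(MV) | R m n }.  The pair {m,n} is unordered, so it
-- belongs to this set as soon as R m n or R n m holds.
⟪_⟫ : Rel MV 0ℓ → PairSet
⟪ R ⟫ = record
  { _∋｛_,_｝ = λ m n → m ≢ n × (R m n ⊎ R n m)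
  ; symmetric = λ (m≢n , r) → (λ n≡m → m≢n (sym n≡m)) , swap r
  ; distinct  = λ (m≢n , _) → m≢n
  }

infix 4 _⊑_

_⊑_ : PairSet → PairSet → Set
D ⊑ E = ∀ {m n} → D ∋｛ m , n ｝ → E ∋｛ m , n ｝

_∪₂_ : PairSet → PairSet → PairSet
D ∪₂ E = ⟪ (λ m n → D ∋｛ m , n ｝ ⊎ E ∋｛ m , n ｝) ⟫

-- D ∩ 𝒫₂(X)
_↾_ : PairSet → List MV → PairSet
D ↾ X = ⟪ (λ m n → D ∋｛ m , n ｝ × m ∈ X × n ∈ X) ⟫

record Language : Set₁ where
  field
    Predicate : Set
    arity     : Predicate → ℕ

module Metalogic (𝓛 : Language) where

  open Language 𝓛

  infix  30 _≐_
  infixr 20 _⇒_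

  data MF : Set where
    meta : fmMV → MF
    _≐_  : vrMV → vrMV → MF
    atom : (P : Predicate) → Vec vrMV (arity P) → MF
    all  : vrMV → MF → MF
    neg  : MF → MF
    _⇒_  : MF → MF → MF

  OC : MF → List MV
  OC (meta p)    = [ inj₂ p ]
  OC (u ≐ v)     = inj₁ u ∷ inj₁ v ∷ []
  OC (atom P us) = map inj₁ (toList us)
  OC (all u Φ)   = inj₁ u ∷ OC Φ
  OC (neg Φ)     = OC Φ
  OC (Φ ⇒ Ψ)     = OC Φ ++ OC Ψ

  record Scheme : Set₁ where
    field
      hypotheses : List MF
      conclusion : MF

    occurring : List MV
    occurring = concatMap OC hypotheses ++ OC conclusion

    field
      DV    : PairSet
      DV⊆OC : ∀ {m n} → DV ∋｛ m , n ｝ → m ∈ occurring × n ∈ occurring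

  open Scheme public

  -- (Γ, Φ₀, D), where D is intersected with 𝒫₂ of the set of metavariables
  -- occurring in Γ or Φ₀.
  scheme : List MF → MF → PairSet → Scheme
  scheme Γ Φ₀ D = record
    { hypotheses = Γ
    ; conclusion = Φ₀
    ; DV         = D ↾ (concatMap OC Γ ++ OC Φ₀)
    ; DV⊆OC      = λ where
        (_ , inj₁ (_ , m∈ , n∈)) → m∈ , n∈
        (_ , inj₂ (_ , n∈ , m∈)) → m∈ , n∈
    }

  -- The two fields give a map σ : MV → vrMV ∪ MF that preserves the kind of
  -- metavariables; σ m = m for every m outside the finite list `support`.
  record Substitution : Set where
    field
      onVr    : vrMV → vrMV
      onFm    : fmMV → MF
      support : List MV
      fixesVr : ∀ {u} → inj₁ u ∉ support → onVr u ≡ u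
      fixesFm : ∀ {p} → inj₂ p ∉ support → onFm p ≡ meta p

  open Substitution public

  infixl 40 _^_

  _^_ : MF → Substitution → MF
  meta p    ^ σ = onFm σ p
  (u ≐ v)   ^ σ = onVr σ u ≐ onVr σ v
  atom P us ^ σ = atom P (Vec.map (onVr σ) us)
  all u Φ   ^ σ = all (onVr σ u) (Φ ^ σ)
  neg Φ     ^ σ = neg (Φ ^ σ)
  (Φ ⇒ Ψ)   ^ σ = Φ ^ σ ⇒ Ψ ^ σ

  -- OC(σ(m))
  OCImage : Substitution → MV → List MV
  OCImage σ (inj₁ u) = [ inj₁ (onVr σ u) ]
  OCImage σ (inj₂ p) = OC (onFm σ p)

  -- D^σ
  _^₂_ : PairSet → Substitution → PairSet
  D ^₂ σ = ⟪ (λ m n → ∃[ m′ ] ∃[ n′ ]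
    (D ∋｛ m′ , n′ ｝ × m ∈ OCImage σ m′ × n ∈ OCImage σ n′)) ⟫

  Legitimate : Substitution → Scheme → Set
  Legitimate σ Φ =
    ∀ {m n} → DV Φ ∋｛ m , n ｝ → Disjoint (OCImage σ m) (OCImage σ n)

  _IsInstanceOf_ : Scheme → Scheme → Set
  Ψ IsInstanceOf Φ = ∃[ σ ]
    ( Legitimate σ Φ
    × hypotheses Ψ ∼[ set ] map (_^ σ) (hypotheses Φ)
    × conclusion Ψ ≡ conclusion Φ ^ σ
    × (DV Φ ^₂ σ) ⊑ DV Ψ )

  -- The set OC(P) for a sequence P of lines of a proof of Φ.
  lineOC : Scheme → ∀ {k} → Vec MF k → List MV
  lineOC Φ P = concatMap OC (toList P) ++ occurring Φ

  -- The set DV(P) for a sequence P of lines of a proof of Φ.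
  lineDV : Scheme → ∀ {k} → Vec MF k → PairSet
  lineDV Φ P = DV Φ ∪₂
    ⟪ (λ m n → m ∈ lineOC Φ P × m ∉ occurring Φ × n ∈ lineOC Φ P) ⟫

  record Proof (S : Pred Scheme (Level.suc 0ℓ)) (Φ : Scheme) : Set₁ where
    field
      {k}      : ℕ
      lines    : Vec MF (suc k)
      lastLine : lookup lines (fromℕ k) ≡ conclusion Φ
      justify  : ∀ i → lookup lines i ∉ hypotheses Φ →
        ∃[ js ] ( All (_< i) js
                × ∃[ Ψ ] ( S Ψ
                         × scheme (map (lookup lines) js) (lookup lines i)
                             (lineDV Φ lines) IsInstanceOf Ψ ) )

  Provable : Pred Scheme (Level.suc 0ℓ) → Scheme → Set₁
  Provable = Proof

  IndependentIn : Pred Scheme (Level.suc 0ℓ) → Scheme → Set₁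
  IndependentIn S Φ = S Φ × ¬ Provable (S ∖ ｛ Φ ｝) Φ

  module System where

    private
      x y z : vrMV
      x = vr 0
      y = vr 1
      z = vr 2

      φ ψ χ θ τ : MF
      φ = meta (fm 0)
      ψ = meta (fm 1)
      χ = meta (fm 2)
      θ = meta (fm 3)
      τ = meta (fm 4)

      -- x, y and φ as elements of MV, for use in disjoint variable conditions
      xᵐ yᵐ φᵐ : MV
      xᵐ = inj₁ x
      yᵐ = inj₁ y
      φᵐ = inj₂ (fm 0)

      infix 4 _⟹_DV_

      _⟹_DV_ : List MF → MF → List (MV × MV) → Scheme
      Γ ⟹ Φ DV pairs = scheme Γ Φ ⟪ (λ m n → (m , n) ∈ pairs) ⟫

    mp minimp peirce contrap notelim gen ALLdistr spec modal5 vacGen ALLcomm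
      EQrefl EQsymm EQtrans denot subst ALLeq genEq : Scheme

    mp       = φ ∷ (φ ⇒ ψ) ∷ [] ⟹ ψ DV []
    minimp   = [] ⟹ φ ⇒ ((ψ ⇒ χ) ⇒ (((θ ⇒ ψ) ⇒ (χ ⇒ τ)) ⇒ (ψ ⇒ τ))) DV []
    peirce   = [] ⟹ ((φ ⇒ ψ) ⇒ φ) ⇒ φ DV []
    contrap  = [] ⟹ (φ ⇒ neg ψ) ⇒ (ψ ⇒ neg φ) DV []
    notelim  = [] ⟹ neg φ ⇒ (φ ⇒ ψ) DV []
    gen      = φ ∷ [] ⟹ all x φ DV []
    ALLdistr = [] ⟹ all x (φ ⇒ ψ) ⇒ (all x φ ⇒ all x ψ) DV []
    spec     = [] ⟹ all x φ ⇒ φ DV []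
    modal5   = [] ⟹ neg (all x φ) ⇒ all x (neg (all x φ)) DV []
    vacGen   = [] ⟹ φ ⇒ all x φ DV [ xᵐ , φᵐ ]
    ALLcomm  = [] ⟹ all x (all y φ) ⇒ all y (all x φ) DV []
    EQrefl   = [] ⟹ x ≐ x DV []
    EQsymm   = [] ⟹ x ≐ y ⇒ y ≐ x DV []
    EQtrans  = [] ⟹ x ≐ y ⇒ (y ≐ z ⇒ x ≐ z) DV []
    denot    = [] ⟹ x ≐ x ⇒ neg (all y (neg (y ≐ x))) DV [ xᵐ , yᵐ ]
    subst    = [] ⟹ all x (x ≐ y ⇒ (φ ⇒ all x (x ≐ y ⇒ φ)))
                 DV (xᵐ , yᵐ) ∷ (yᵐ , φᵐ) ∷ []
    ALLeq    = [] ⟹ all x (x ≐ y) ⇒ (all x φ ⇒ all y φ) DV []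
    genEq    = [] ⟹ neg (all x (x ≐ y)) ⇒
                     (neg (all x (x ≐ z)) ⇒ (y ≐ z ⇒ all x (y ≐ z))) DV []

    TMM : Pred Scheme (Level.suc 0ℓ)
    TMM Φ = Φ ∈ mp ∷ minimp ∷ peirce ∷ contrap ∷ notelim ∷ gen ∷ ALLdistr
              ∷ spec ∷ modal5 ∷ vacGen ∷ ALLcomm ∷ EQrefl ∷ EQsymm ∷ EQtrans
              ∷ denot ∷ subst ∷ ALLeq ∷ genEq ∷ []

  open System public

{-# OPTIONS --safe #-}

-- Each independence is witnessed by a nonstandard semantics: metaformulas get
-- values in a structure in which all the other schemes hold while the given
-- one fails.  DV conditions on formula metavariables matter only for vacGen, for
-- which values carry a notion of freshness of a variable; a formula metavariable
-- may have a value depending on a variable x unless DV(P) separates it from x.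
-- Propositional schemes are refuted by finite matrices in which ∀ is the
-- identity and ≡ is constantly true.  For most of the others, ∀x is read over
-- assignments as a modality "for all values of x accessible from the present
-- one": the full relation gives Tarskian semantics, equality makes the
-- quantifiers vacuous, and a non-Euclidean relation refutes modal5.  ALLdistr
-- needs a reading of ∀x that depends on which variables the formula contains.

module Submission where

open import Defs
open import Level using (Level; 0ℓ; _⊔_) renaming (suc to lsuc)
open import Data.Bool as Bool using (Bool; true; false; not; _∨_; if_then_else_; T)
open import Data.Bool.Properties as Bool using (T?)
open import Data.Empty using (⊥; ⊥-elim)
open import Data.Fin as Fin using (Fin; fromℕ; #_)
open import Data.Fin.Induction using (<-wellFounded)
open import Data.Fin.Patterns using (0F; 1F; 2F; 3F; 4F; 5F; 6F; 8F; 9F)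
open import Data.Fin.Properties using (all?)
open import Data.List using ([]; _∷_; map)
open import Data.List.Membership.Propositional using (_∈_; _∉_)
open import Data.List.Membership.Propositional.Properties using (∈-lookup; ∈-++⁺ˡ; ∈-++⁺ʳ)
open import Data.List.Relation.Unary.All as All using (All; []; _∷_)
import Data.List.Relation.Unary.All.Properties as All
open import Data.List.Relation.Unary.Any using (here; there)
open import Data.Nat as ℕ using (ℕ; suc; ∣_-_∣; z≤n; s≤s)
import Data.Nat.Properties as ℕ
open import Data.Product using (_×_; _,_; ∃-syntax; proj₁; proj₂)
open import Data.Sum using (_⊎_; inj₁; inj₂; [_,_])
open import Data.Unit using (⊤; tt)
open import Data.Vec as Vec using (Vec; lookup)
open import Function using (_∘_; const; id; case_of_)
open import Function.Bundles using (module Equivalence)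
open import Induction.WellFounded using (Acc; acc)
open import Relation.Binary.Core using (Rel)
open import Relation.Binary.Definitions using (DecidableEquality; Reflexive; Symmetric; Transitive)
open import Relation.Binary.PropositionalEquality using (_≡_; _≢_; _≗_; refl; sym; trans; cong; subst₂; ≢-sym)
import Relation.Binary.PropositionalEquality as ≡
open import Relation.Nullary using (¬_; Dec; yes; no; does; contradiction)
open import Relation.Nullary.Decidable using (map′; decidable-stable; from-yes; _×-dec_; _→-dec_)
open import Relation.Nullary.Negation using (Stable; negated-stable)
open import Relation.Unary using (Pred; ｛_｝; _∖_; _∪_)

_≟_ : DecidableEquality vrMV
vr m ≟ vr n = map′ (cong vr) (λ { refl → refl }) (m ℕ.≟ n)

module _ (𝓛 : Language) where

  open Metalogic 𝓛

  private variable
    ℓ : Level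

  -- Structures for metaformulas and the laws asked of them

  record Structure ℓ : Set (lsuc ℓ) where
    infixr 20 _⊃_
    field
      V   : Set ℓ
      _⊃_ : V → V → V
      ∼   : V → V
      Q   : vrMV → V → V
      eq  : vrMV → vrMV → V
      -- No scheme of `TMM` mentions a predicate, so all atoms can share one value.
      at  : V
      val : fmMV → V

      Designated : V → Set
      stable     : ∀ v → Stable (Designated v)

      _#_  : vrMV → V → Set
      #-⊃  : ∀ {x a b} → x # a → x # b → x # (a ⊃ b)
      #-∼  : ∀ {x a} → x # a → x # ∼ a
      #-Q  : ∀ {x y a} → x ≢ y → x # a → x # Q y a
      #-eq : ∀ {x y z} → x ≢ y → x ≢ z → x # eq y z
      #-at : ∀ {x} → x # at

    ⟦_⟧ : MF → V
    ⟦ meta p ⟧   = val p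
    ⟦ u ≐ v ⟧    = eq u v
    ⟦ atom P _ ⟧ = at
    ⟦ all u Φ ⟧  = Q u ⟦ Φ ⟧
    ⟦ neg Φ ⟧    = ∼ ⟦ Φ ⟧
    ⟦ Φ ⇒ Ψ ⟧    = ⟦ Φ ⟧ ⊃ ⟦ Ψ ⟧

    Holds : MF → Set
    Holds Φ = Designated ⟦ Φ ⟧

    Respects : (vrMV → fmMV → Set) → Set
    Respects S = ∀ {u p} → S u p → u # val p

  -- A substitution can send a formula metavariable to any metaformula, so each law ranges over all
  -- of `V` and not only over the values of `val`. `X` collects the schemes whose law is waived.
  record Laws (M : Structure ℓ) (X : Pred Scheme (lsuc 0ℓ)) : Set (lsuc 0ℓ ⊔ ℓ) where
    open Structure M renaming (Designated to D)
    field
      mp-law       : ¬ X mp → ∀ {a b} → D a → D (a ⊃ b) → D b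
      minimp-law   : ¬ X minimp → ∀ a b c d e →
                     D (a ⊃ (b ⊃ c) ⊃ ((d ⊃ b) ⊃ c ⊃ e) ⊃ b ⊃ e)
      peirce-law   : ¬ X peirce → ∀ a b → D (((a ⊃ b) ⊃ a) ⊃ a)
      contrap-law  : ¬ X contrap → ∀ a b → D ((a ⊃ ∼ b) ⊃ b ⊃ ∼ a)
      notelim-law  : ¬ X notelim → ∀ a b → D (∼ a ⊃ a ⊃ b)
      gen-law      : ¬ X gen → ∀ x {a} → D a → D (Q x a)
      ALLdistr-law : ¬ X ALLdistr → ∀ x a b → D (Q x (a ⊃ b) ⊃ Q x a ⊃ Q x b)
      spec-law     : ¬ X spec → ∀ x a → D (Q x a ⊃ a)
      modal5-law   : ¬ X modal5 → ∀ x a → D (∼ (Q x a) ⊃ Q x (∼ (Q x a)))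
      vacGen-law   : ¬ X vacGen → ∀ {x a} → x # a → D (a ⊃ Q x a)
      ALLcomm-law  : ¬ X ALLcomm → ∀ x y a → D (Q x (Q y a) ⊃ Q y (Q x a))
      EQrefl-law   : ¬ X EQrefl → ∀ x → D (eq x x)
      EQsymm-law   : ¬ X EQsymm → ∀ x y → D (eq x y ⊃ eq y x)
      EQtrans-law  : ¬ X EQtrans → ∀ x y z → D (eq x y ⊃ eq y z ⊃ eq x z)
      denot-law    : ¬ X denot → ∀ {x y} → x ≢ y → D (eq x x ⊃ ∼ (Q y (∼ (eq y x))))
      subst-law    : ¬ X subst → ∀ {x y} → x ≢ y → ∀ a →
                     D (Q x (eq x y ⊃ a ⊃ Q x (eq x y ⊃ a)))
      ALLeq-law    : ¬ X ALLeq → ∀ x y a → D (Q x (eq x y) ⊃ Q x a ⊃ Q y a)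
      genEq-law    : ¬ X genEq → ∀ x y z →
                     D (∼ (Q x (eq x y)) ⊃ ∼ (Q x (eq x z)) ⊃ eq y z ⊃ Q x (eq y z))

  -- Soundness of proofs in a structure

  -- What membership of {u,p} in DV(P), for P a proof of Φ, implies: dummy
  -- metavariables of P are separated from everything.
  Separated : Scheme → vrMV → fmMV → Set
  Separated Φ u p =
    DV Φ ∋｛ inj₁ u , inj₂ p ｝ ⊎ ¬ (inj₁ u ∈ occurring Φ × inj₂ p ∈ occurring Φ)

  lineDV⇒Separated : ∀ {Φ k} (P : Vec MF k) {u p} →
    lineDV Φ P ∋｛ inj₁ u , inj₂ p ｝ → Separated Φ u p
  lineDV⇒Separated {Φ} P (_ , inj₁ (inj₁ d)) = inj₁ d
  lineDV⇒Separated {Φ} P (_ , inj₂ (inj₁ d)) = inj₁ (PairSet.symmetric (DV Φ) d)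
  lineDV⇒Separated P (_ , inj₁ (inj₂ (_ , inj₁ (_ , u∉ , _)))) = inj₂ (u∉ ∘ proj₁)
  lineDV⇒Separated P (_ , inj₁ (inj₂ (_ , inj₂ (_ , p∉ , _)))) = inj₂ (p∉ ∘ proj₂)
  lineDV⇒Separated P (_ , inj₂ (inj₂ (_ , inj₁ (_ , p∉ , _)))) = inj₂ (p∉ ∘ proj₂)
  lineDV⇒Separated P (_ , inj₂ (inj₂ (_ , inj₂ (_ , u∉ , _)))) = inj₂ (u∉ ∘ proj₁)

  ↾-⊑ : ∀ E X → (E ↾ X) ⊑ E
  ↾-⊑ E X (_ , inj₁ (e , _)) = e
  ↾-⊑ E X (_ , inj₂ (e , _)) = PairSet.symmetric E e

  module Soundness (M : Structure ℓ) {X : Pred Scheme (lsuc 0ℓ)} (laws : Laws M X) (E : PairSet)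
    (fresh : ¬ X vacGen → Structure.Respects M (λ u p → E ∋｛ inj₁ u , inj₂ p ｝)) where

    open Structure M
    open Laws laws

    #-⟦_⟧ : ¬ X vacGen → ∀ Φ {x} →
      -- `OC` counts variables directly after quantifiers, so `x` also differs from every bound
      -- variable, as the clause for `all` requires.
      (∀ {m} → m ∈ OC Φ → inj₁ x ≢ m × E ∋｛ inj₁ x , m ｝) → x # ⟦ Φ ⟧
    #-⟦ ¬v ⟧ (meta p)   f = fresh ¬v (proj₂ (f (here refl)))
    #-⟦ ¬v ⟧ (u ≐ v)    f = #-eq (proj₁ (f (here refl)) ∘ cong inj₁)
                                 (proj₁ (f (there (here refl))) ∘ cong inj₁)
    #-⟦ ¬v ⟧ (atom P _) f = #-at
    #-⟦ ¬v ⟧ (all u Φ)  f = #-Q (proj₁ (f (here refl)) ∘ cong inj₁) (#-⟦ ¬v ⟧ Φ (f ∘ there))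
    #-⟦ ¬v ⟧ (neg Φ)    f = #-∼ (#-⟦ ¬v ⟧ Φ f)
    #-⟦ ¬v ⟧ (Φ ⇒ Ψ)    f = #-⊃ (#-⟦ ¬v ⟧ Φ (f ∘ ∈-++⁺ˡ)) (#-⟦ ¬v ⟧ Ψ (f ∘ ∈-++⁺ʳ (OC Φ)))

    Sound : Scheme → Set
    Sound Ψ = ∀ σ → Legitimate σ Ψ → (DV Ψ ^₂ σ) ⊑ E →
      All Holds (map (_^ σ) (hypotheses Ψ)) → Holds (conclusion Ψ ^ σ)

    vacGen-sound : ¬ X vacGen → Sound vacGen
    vacGen-sound ¬v σ legit DV⊑E _ = vacGen-law ¬v (#-⟦ ¬v ⟧ (onFm σ (fm 0)) separated)
      where
      x,φ : DV vacGen ∋｛ inj₁ (vr 0) , inj₂ (fm 0) ｝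
      x,φ = (λ ()) , inj₁ (((λ ()) , inj₁ (here refl)) , there (here refl) , here refl)

      separated : ∀ {m} → m ∈ OC (onFm σ (fm 0)) →
        inj₁ (onVr σ (vr 0)) ≢ m × E ∋｛ inj₁ (onVr σ (vr 0)) , m ｝
      separated m∈ = x≢m , DV⊑E (x≢m , inj₁ (_ , _ , x,φ , here refl , m∈))
        where x≢m = λ { refl → legit x,φ (here refl , m∈) }

    denot-sound : ¬ X denot → Sound denot
    denot-sound ¬d σ legit _ _ = denot-law ¬d λ x≡y →
      legit {inj₁ (vr 0)} {inj₁ (vr 1)}
        ((λ ()) , inj₁ (((λ ()) , inj₁ (here refl)) , here refl , there (there (here refl))))
        (here refl , here (cong inj₁ x≡y))

    subst-sound : ¬ X subst → Sound subst
    subst-sound ¬s σ legit _ _ = subst-law ¬s (λ x≡y →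
      legit {inj₁ (vr 0)} {inj₁ (vr 1)}
        ((λ ()) , inj₁ (((λ ()) , inj₁ (here refl)) , here refl , there (there (here refl))))
        (here refl , here (cong inj₁ x≡y))) _

    sound : ∀ {Ψ} → TMM Ψ → ¬ X Ψ → Sound Ψ
    sound Ψ∈ = All.lookup {P = λ Ψ → ¬ X Ψ → Sound Ψ}
      ( (λ { ¬X _ _ _ (a ∷ a⊃b ∷ []) → mp-law ¬X a a⊃b })
      ∷ (λ ¬X _ _ _ _ → minimp-law ¬X _ _ _ _ _)
      ∷ (λ ¬X _ _ _ _ → peirce-law ¬X _ _)
      ∷ (λ ¬X _ _ _ _ → contrap-law ¬X _ _)
      ∷ (λ ¬X _ _ _ _ → notelim-law ¬X _ _)
      ∷ (λ { ¬X _ _ _ (a ∷ []) → gen-law ¬X _ a })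
      ∷ (λ ¬X _ _ _ _ → ALLdistr-law ¬X _ _ _)
      ∷ (λ ¬X _ _ _ _ → spec-law ¬X _ _)
      ∷ (λ ¬X _ _ _ _ → modal5-law ¬X _ _)
      ∷ vacGen-sound
      ∷ (λ ¬X _ _ _ _ → ALLcomm-law ¬X _ _ _)
      ∷ (λ ¬X _ _ _ _ → EQrefl-law ¬X _)
      ∷ (λ ¬X _ _ _ _ → EQsymm-law ¬X _ _)
      ∷ (λ ¬X _ _ _ _ → EQtrans-law ¬X _ _ _)
      ∷ denot-sound
      ∷ subst-sound
      ∷ (λ ¬X _ _ _ _ → ALLeq-law ¬X _ _ _)
      ∷ (λ ¬X _ _ _ _ → genEq-law ¬X _ _ _)
      ∷ []) Ψ∈

  module _ (M : Structure ℓ) where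
    open Structure M

    -- Truth passes from line to line by well-founded induction on positions. As `Separated Φ`
    -- refers to `Φ` alone, freshness can be checked before any proof is given.
    unprovable : ∀ {X S Φ} → Laws M X → (∀ {Ψ} → S Ψ → TMM Ψ × ¬ X Ψ) →
      (¬ X vacGen → Respects (Separated Φ)) →
      All Holds (hypotheses Φ) → ¬ Holds (conclusion Φ) → ¬ Provable S Φ
    unprovable {Φ = Φ} laws S⊆ fresh hyps ¬concl P =
      ¬concl (≡.subst Holds lastLine (line-holds (fromℕ k) (<-wellFounded _)))
      where
      open Proof P
      open Soundness M laws (lineDV Φ lines) (λ ¬v → fresh ¬v ∘ lineDV⇒Separated {Φ} lines)

      line-holds : ∀ i → Acc Fin._<_ i → Holds (lookup lines i)
      -- Whether a line is a hypothesis is not decidable over an arbitrary language,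
      -- so stability replaces the case distinction.
      line-holds i (acc rs) = stable _ λ ¬holds →
        let js , js<i , Ψ , SΨ , σ , legit , hyp∼ , concl≡ , DV⊑ =
              justify i (¬holds ∘ All.lookup hyps)
            premises : All Holds (map (lookup lines) js)
            premises = All.map⁺ (All.map (λ {j} j<i → line-holds j (rs j<i)) js<i)
        in ¬holds (≡.subst Holds (sym concl≡)
             (sound (proj₁ (S⊆ SΨ)) (proj₂ (S⊆ SΨ)) σ legit (↾-⊑ (lineDV Φ lines) _ ∘ DV⊑)
               (All.tabulate (All.lookup premises ∘ Equivalence.from hyp∼))))

    unprovable-without : ∀ {A : Pred Scheme (lsuc 0ℓ)} {Φ} → Laws M (A ∪ ｛ Φ ｝) → Respects (Separated Φ) →
      All Holds (hypotheses Φ) → ¬ Holds (conclusion Φ) → ¬ Provable ((TMM ∖ A) ∖ ｛ Φ ｝) Φ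
    unprovable-without laws fresh =
      unprovable laws (λ ((Ψ∈ , ∉A) , ≢Φ) → Ψ∈ , [ ∉A , ≢Φ ]) (λ _ → fresh)

  -- Kripke semantics over assignments

  record Frame : Set₁ where
    field
      D        : Set
      -- ∀x Φ holds at s when Φ holds at s[x ≔ d] for all d with s x R d.
      _R_      : Rel D 0ℓ
      R-refl   : Reflexive _R_
      _≈_      : Rel D 0ℓ
      ≈-stable : ∀ a b → Stable (a ≈ b)

    record Admissible (X : Pred Scheme (lsuc 0ℓ)) : Set₁ where
      field
        R-euclidean : ¬ X modal5 → ∀ {a b c} → a R b → a R c → b R c
        ≈-refl      : ¬ X EQrefl → Reflexive _≈_
        ≈-sym       : ¬ X EQsymm → Symmetric _≈_
        ≈-trans     : ¬ X EQtrans → Transitive _≈_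
        denoting    : ¬ X denot → ∀ {a} → a ≈ a → ∀ b → ∃[ c ] (b R c × c ≈ a)
        injective   : ¬ X subst → ∀ {a b c} → b ≈ a → c ≈ a → b R c → b ≡ c
        -- This serves ALLeq and genEq. In the first case quantifiers are vacuous. In the second,
        -- escaping makes `all x (x ≐ y)` false for distinct variables, which settles ALLeq;
        -- reflexivity makes it true when they coincide, which leaves genEq only with `x` apart from
        -- `y` and `z`.
        trivial-or-escaping :
          (∀ {a b} → a R b → a ≡ b) ⊎
          (Reflexive _≈_ × (¬ X ALLeq → ∀ a b → ∃[ c ] (b R c × ¬ c ≈ a)))

  -- Truth is tested at the `Actual` assignments only; restricting them is what refutes gen.
  module Kripke (F : Frame) (p : Frame.D F → Set) (p-stable : ∀ d → Stable (p d))
    (Actual : Pred (vrMV → Frame.D F) 0ℓ) where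

    open Frame F

    infixl 30 _[_≔_]

    _[_≔_] : (vrMV → D) → vrMV → D → vrMV → D
    (s [ x ≔ d ]) y = if does (y ≟ x) then d else s y

    at-≔ : ∀ s x d → (s [ x ≔ d ]) x ≡ d
    at-≔ s x d with x ≟ x
    ... | yes _  = refl
    ... | no x≢x = contradiction refl x≢x

    off-≔ : ∀ s {x y} d → y ≢ x → (s [ x ≔ d ]) y ≡ s y
    off-≔ s {x} {y} d y≢x with y ≟ x
    ... | yes y≡x = contradiction y≡x y≢x
    ... | no _    = refl

    ≔-self : ∀ s {x d} → s x ≡ d → s [ x ≔ d ] ≗ s
    ≔-self s {x} sx≡d y with y ≟ x
    ... | yes refl = sym sx≡d
    ... | no _     = refl

    ≔-cong : ∀ {s t} x d → s ≗ t → s [ x ≔ d ] ≗ t [ x ≔ d ]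
    ≔-cong x d s≗t y with y ≟ x
    ... | yes _ = refl
    ... | no _  = s≗t y

    ≔-≔ : ∀ s x d e → s [ x ≔ d ] [ x ≔ e ] ≗ s [ x ≔ e ]
    ≔-≔ s x d e y with y ≟ x
    ... | yes _  = refl
    ... | no _   = refl

    ≔-comm : ∀ s {x y} d e → x ≢ y → s [ x ≔ d ] [ y ≔ e ] ≗ s [ y ≔ e ] [ x ≔ d ]
    ≔-comm s {x} {y} d e x≢y z with z ≟ x | z ≟ y
    ... | yes refl | yes refl = contradiction refl x≢y
    ... | yes _    | no _     = refl
    ... | no _     | yes _    = refl
    ... | no _     | no _     = refl

    -- `resp` stands in for function extensionality on assignments, and `stable` supplies the
    -- classical reasoning that peirce calls for.
    record Property : Set₁ where
      field
        holds  : Pred (vrMV → D) 0ℓ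
        resp   : ∀ {s t} → s ≗ t → holds s → holds t
        stable : ∀ s → Stable (holds s)

    open Property

    _⊃_ : Property → Property → Property
    a ⊃ b = record
      { holds  = λ s → holds a s → holds b s
      ; resp   = λ s≗t f → resp b s≗t ∘ f ∘ resp a (sym ∘ s≗t)
      ; stable = λ s ¬¬f as → stable b s λ ¬bs → ¬¬f λ f → ¬bs (f as)
      }

    ∼ : Property → Property
    ∼ a = record
      { holds  = λ s → ¬ holds a s
      ; resp   = λ s≗t ¬a → ¬a ∘ resp a (sym ∘ s≗t)
      ; stable = λ s → negated-stable
      }

    Q : vrMV → Property → Property
    Q x a = record
      { holds  = λ s → ∀ {d} → s x R d → holds a (s [ x ≔ d ])
      ; resp   = λ s≗t f r → resp a (≔-cong x _ s≗t) (f (≡.subst (_R _) (sym (s≗t x)) r))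
      ; stable = λ s ¬¬f r → stable a _ λ ¬a → ¬¬f λ f → ¬a (f r)
      }

    eq : vrMV → vrMV → Property
    eq u v = record
      { holds  = λ s → s u ≈ s v
      ; resp   = λ s≗t → subst₂ _≈_ (s≗t u) (s≗t v)
      ; stable = λ s → ≈-stable _ _
      }

    always : Property
    always = record { holds = λ _ → ⊤ ; resp = λ _ _ → tt ; stable = λ _ _ → tt }

    -- The `φ` of the schemes is made to depend on the value of their variable `x`, so that
    -- quantifying `x` can change its truth.
    val : fmMV → Property
    val (fm 0) = record
      { holds  = λ s → p (s (vr 0))
      ; resp   = λ s≗t → ≡.subst p (s≗t (vr 0))
      ; stable = λ s → p-stable _
      }
    val (fm (suc _)) = always

    infix 4 _#_

    -- One direction is enough: updating `x` back to its old value gives the converse, `unupdate`.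
    _#_ : vrMV → Property → Set
    x # a = ∀ s d → holds a s → holds a (s [ x ≔ d ])

    unupdate : ∀ {x} a → x # a → ∀ s d → holds a (s [ x ≔ d ]) → holds a s
    unupdate {x} a x#a s d h =
      resp a (λ y → trans (≔-≔ s x d (s x) y) (≔-self s refl y)) (x#a _ (s x) h)

    #-Q : ∀ {x y a} → x ≢ y → x # a → x # Q y a
    #-Q {x} {y} {a} x≢y x#a s d f r =
      resp a (≔-comm s _ _ (≢-sym x≢y))
        (x#a _ d (f (≡.subst (_R _) (off-≔ s d (≢-sym x≢y)) r)))

    #-eq : ∀ {x y z} → x ≢ y → x ≢ z → x # eq y z
    #-eq x≢y x≢z s d =
      subst₂ _≈_ (sym (off-≔ s d (≢-sym x≢y))) (sym (off-≔ s d (≢-sym x≢z)))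

    #-val : ∀ {x} q → (∀ d → p d) ⊎ (x ≡ vr 0 → q ≢ fm 0) → x # val q
    #-val {x} (fm 0)       (inj₁ p-all) s d _ = p-all _
    #-val {x} (fm 0)       (inj₂ apart) s d   =
      ≡.subst p (sym (off-≔ s {x} d λ { refl → apart refl refl }))
    #-val {x} (fm (suc _)) _            s d _ = tt

    structure : Structure (lsuc 0ℓ)
    structure = record
      { V = Property ; _⊃_ = _⊃_ ; ∼ = ∼ ; Q = Q ; eq = eq ; at = always ; val = val
      ; Designated = λ a → ∀ s → Actual s → holds a s
      ; stable = λ a ¬¬f s As → stable a s λ ¬a → ¬¬f λ f → ¬a (f s As)
      ; _#_  = _#_
      ; #-⊃  = λ {x} {a} {b} x#a x#b s d f → x#b s d ∘ f ∘ unupdate a x#a s d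
      ; #-∼  = λ {x} {a} x#a s d ¬a → ¬a ∘ unupdate a x#a s d
      ; #-Q  = λ {x} {y} {a} → #-Q {a = a}
      ; #-eq = #-eq
      ; #-at = λ _ _ _ → tt
      }

    laws : ∀ {X} → Admissible X → (¬ X gen → ∀ s → Actual s) → Laws structure X
    laws {X} F-admissible all-actual = record
      { mp-law       = λ _ a a⊃b s As → a⊃b s As (a s As)
      ; minimp-law   = λ _ _ _ _ _ _ _ _ _ f g b → g (λ _ → b) (f b)
      ; peirce-law   = λ _ a _ s _ f → stable a s λ ¬a → ¬a (f λ h → contradiction h ¬a)
      ; contrap-law  = λ _ _ _ _ _ f b a → f a b
      ; notelim-law  = λ _ _ _ _ _ ¬a a → contradiction a ¬a
      ; gen-law      = λ ¬X _ a _ _ _ → a _ (all-actual ¬X _)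
      ; ALLdistr-law = λ _ _ _ _ _ _ f g r → f r (g r)
      ; spec-law     = λ _ x a s _ f → resp a (≔-self s refl) (f R-refl)
      -- By Euclideanness the new value of `x` sees everything that the old one sees, so a universal
      -- claim at the updated assignment carries back to `s`.
      ; modal5-law   = λ ¬X x a s _ ¬f r g → ¬f λ r′ → resp a (≔-≔ s x _ _)
          (g (≡.subst (_R _) (sym (at-≔ s x _)) (R-euclidean ¬X r r′)))
      ; vacGen-law   = λ _ x#a s _ as _ → x#a s _ as
      ; ALLcomm-law  = λ _ → ALLcomm-law
      ; EQrefl-law   = λ ¬X _ _ _ → ≈-refl ¬X
      ; EQsymm-law   = λ ¬X _ _ _ _ → ≈-sym ¬X
      ; EQtrans-law  = λ ¬X _ _ _ _ _ → ≈-trans ¬X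
      ; denot-law    = denot-law
      ; subst-law    = subst-law
      ; ALLeq-law    = ALLeq-law
      ; genEq-law    = λ _ → genEq-law
      }
      where
      open Admissible F-admissible
      open Structure structure using () renaming (Designated to ⊩)

      -- Accessibility looks only at the value of the quantified variable, so moves along distinct
      -- variables commute.
      ALLcomm-law : ∀ x y a → ⊩ (Q x (Q y a) ⊃ Q y (Q x a))
      ALLcomm-law x y a = case x ≟ y of λ where
        (yes refl) s _ f           → f
        (no x≢y)   s _ f {d} r {e} r′ → resp a (≔-comm s e d x≢y)
          (f (≡.subst (_R _) (off-≔ s d x≢y) r′)
             (≡.subst (_R _) (sym (off-≔ s e (≢-sym x≢y))) r))

      denot-law : ¬ X denot → ∀ {x y} → x ≢ y → ⊩ (eq x x ⊃ ∼ (Q y (∼ (eq y x))))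
      denot-law ¬X {x} {y} x≢y s _ x≈x f with denoting ¬X x≈x (s y)
      ... | c , r , c≈x = f r (subst₂ _≈_ (sym (at-≔ s y c)) (sym (off-≔ s c x≢y)) c≈x)

      -- Once `x ≐ y` holds, `injective` leaves the present value of `x` as the only accessible one
      -- that keeps it true, so the inner quantifier returns to the present assignment.
      subst-law : ¬ X subst → ∀ {x y} → x ≢ y → ∀ a → ⊩ (Q x (eq x y ⊃ (a ⊃ Q x (eq x y ⊃ a))))
      subst-law ¬X {x} {y} x≢y a s _ {d} _ x≈y as {e} r x≈y′ =
        resp a (sym ∘ ≔-self t (injective ¬X x≈y
          (subst₂ _≈_ (at-≔ t x e) (off-≔ t e (≢-sym x≢y)) x≈y′) r)) as
        where t = s [ x ≔ d ]

      ALLeq-law : ¬ X ALLeq → ∀ x y a → ⊩ (Q x (eq x y) ⊃ (Q x a ⊃ Q y a))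
      ALLeq-law ¬X x y a s _ f g r with x ≟ y | trivial-or-escaping
      ... | yes refl | _            = g r
      ... | no _     | inj₁ trivial =
        resp a (λ z → trans (≔-self s refl z) (sym (≔-self s (trivial r) z))) (g R-refl)
      ... | no x≢y   | inj₂ (_ , escaping) with escaping ¬X (s y) (s x)
      ...   | c , r′ , c≉y = contradiction
        (subst₂ _≈_ (at-≔ s x c) (off-≔ s c (≢-sym x≢y)) (f r′)) c≉y

      genEq-law : ∀ x y z →
        ⊩ (∼ (Q x (eq x y)) ⊃ (∼ (Q x (eq x z)) ⊃ (eq y z ⊃ Q x (eq y z))))
      genEq-law x y z s _ x≉y x≉z y≈z r with trivial-or-escaping
      ... | inj₁ trivial = resp (eq y z) (sym ∘ ≔-self s (trivial r)) y≈z
      ... | inj₂ (≈-refl , _) with x ≟ y | x ≟ z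
      ...   | yes refl | _        = ⊥-elim (x≉y λ _ → ≈-refl)
      ...   | no _     | yes refl = ⊥-elim (x≉z λ _ → ≈-refl)
      ...   | no x≢y   | no x≢z   = #-eq x≢y x≢z s _ y≈z

  -- Finite matrices

  module Matrix {n} (_⊃_ : Fin n → Fin n → Fin n) (∼ : Fin n → Fin n) (top : Fin n)
    (designated : Fin n → Bool) (val : fmMV → Fin n) where

    D : Fin n → Set
    D a = T (designated a)

    structure : Structure 0ℓ
    structure = record
      { V = Fin n ; _⊃_ = _⊃_ ; ∼ = ∼ ; Q = λ _ a → a ; eq = λ _ _ → top ; at = top ; val = val
      ; Designated = D
      ; stable = λ a → decidable-stable (T? (designated a))
      ; _#_ = λ _ _ → ⊤
      }

    -- With the quantifier the identity and equality constant, all quantifier and equality schemes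
    -- except gen collapse to the shapes in `Identity` and `Top`, so finite search decides
    -- everything.
    MP Minimp Peirce Contrap Notelim Identity Top : Set
    MP       = ∀ a b → D a → D (a ⊃ b) → D b
    Minimp   = ∀ a b c d e → D (a ⊃ ((b ⊃ c) ⊃ (((d ⊃ b) ⊃ (c ⊃ e)) ⊃ (b ⊃ e))))
    Peirce   = ∀ a b → D (((a ⊃ b) ⊃ a) ⊃ a)
    Contrap  = ∀ a b → D ((a ⊃ ∼ b) ⊃ (b ⊃ ∼ a))
    Notelim  = ∀ a b → D (∼ a ⊃ (a ⊃ b))
    Identity = ∀ a → D (a ⊃ a) × D (top ⊃ (a ⊃ a)) × D (top ⊃ (a ⊃ (top ⊃ a)))
    Top      = D top × D (top ⊃ ∼ (∼ top)) × D (∼ top ⊃ (∼ top ⊃ (top ⊃ top)))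

    mp? : Dec MP
    mp? = all? λ a → all? λ b → T? _ →-dec (T? _ →-dec T? _)

    minimp? : Dec Minimp
    minimp? = all? λ a → all? λ b → all? λ c → all? λ d → all? λ e → T? _

    peirce? : Dec Peirce
    peirce? = all? λ a → all? λ b → T? _

    contrap? : Dec Contrap
    contrap? = all? λ a → all? λ b → T? _

    notelim? : Dec Notelim
    notelim? = all? λ a → all? λ b → T? _

    identity? : Dec Identity
    identity? = all? λ a → T? _ ×-dec (T? _ ×-dec T? _)

    top? : Dec Top
    top? = T? _ ×-dec (T? _ ×-dec T? _)

    laws : ∀ {X} → (¬ X mp → MP) → (¬ X minimp → Minimp) → (¬ X peirce → Peirce) →
      (¬ X contrap → Contrap) → (¬ X notelim → Notelim) → Identity → Top → Laws structure X
    laws MP Minimp Peirce Contrap Notelim Identity (⊩top , denot-top , genEq-top) = record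
      { mp-law       = λ ¬X → MP ¬X _ _
      ; minimp-law   = Minimp
      ; peirce-law   = Peirce
      ; contrap-law  = Contrap
      ; notelim-law  = Notelim
      ; gen-law      = λ _ _ a → a
      ; ALLdistr-law = λ _ _ a b → proj₁ (Identity (a ⊃ b))
      ; spec-law     = λ _ _ a → proj₁ (Identity a)
      ; modal5-law   = λ _ _ a → proj₁ (Identity (∼ a))
      ; vacGen-law   = λ _ {_} {a} _ → proj₁ (Identity a)
      ; ALLcomm-law  = λ _ _ _ a → proj₁ (Identity a)
      ; EQrefl-law   = λ _ _ → ⊩top
      ; EQsymm-law   = λ _ _ _ → proj₁ (Identity top)
      ; EQtrans-law  = λ _ _ _ _ → proj₁ (proj₂ (Identity top))
      ; denot-law    = λ _ _ → denot-top
      ; subst-law    = λ _ _ a → proj₂ (proj₂ (Identity a))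
      ; ALLeq-law    = λ _ _ _ a → proj₁ (proj₂ (Identity a))
      ; genEq-law    = λ _ _ _ _ → genEq-top
      }

  -- A semantics that tracks free variables

  -- Values are sets of free variables together with a property of two worlds.
  -- ∀x is the universal modality on formulas with x free and the identity on the
  -- others.  Distribution of ∀x over φ → ψ fails when x is free in ψ only, since
  -- ∀x φ, being φ itself, then need not hold in the other world.
  module Tracked where

    record Proposition : Set₁ where
      field
        Free   : Pred vrMV 0ℓ
        holds  : Pred Bool 0ℓ
        stable : ∀ w → Stable (holds w)

    open Proposition

    _⊃_ : Proposition → Proposition → Proposition
    a ⊃ b = record
      { Free   = Free a ∪ Free b
      ; holds  = λ w → holds a w → holds b w
      ; stable = λ w ¬¬f aw → stable b w λ ¬bw → ¬¬f λ f → ¬bw (f aw)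
      }

    ∼ : Proposition → Proposition
    ∼ a = record { Free = Free a ; holds = λ w → ¬ holds a w ; stable = λ w → negated-stable }

    -- Binding `x` leaves it in `Free`, so the conditions of two nested quantifiers refer to the
    -- same set and can be exchanged for ALLcomm.
    Q : vrMV → Proposition → Proposition
    Q x a = record
      { Free   = Free a
      ; holds  = λ w → holds a w × (Free a x → ∀ w′ → holds a w′)
      ; stable = λ w ¬¬f → stable a w (λ ¬a → ¬¬f (¬a ∘ proj₁)) ,
          λ x∈ w′ → stable a w′ λ ¬a → ¬¬f λ (_ , f) → ¬a (f x∈ w′)
      }

    -- World `true` identifies all variables and world `false` none. Hence denot finds its witness
    -- in `true`, while `all x (x ≐ y)` with distinct variables fails because of `false`.
    eq : vrMV → vrMV → Proposition
    eq u v = record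
      { Free   = ｛ u ｝ ∪ ｛ v ｝
      ; holds  = λ w → u ≢ v → T w
      ; stable = λ w ¬¬f u≢v → decidable-stable (T? w) λ ¬w → ¬¬f λ f → ¬w (f u≢v)
      }

    always : Proposition
    always = record { Free = λ _ → ⊥ ; holds = λ _ → ⊤ ; stable = λ _ _ → tt }

    -- `φ` and `ψ` agree in both worlds, so their implication holds throughout. In world `true`,
    -- `all x` keeps `φ` true, but it makes `ψ`, which has `x` free, false.
    val : fmMV → Proposition
    val (fm 0) = record { Free = λ _ → ⊥ ; holds = T ; stable = λ w → decidable-stable (T? w) }
    val (fm 1) = record { Free = ｛ vr 0 ｝ ; holds = T ; stable = λ w → decidable-stable (T? w) }
    val _      = always

    structure : Structure (lsuc 0ℓ)
    structure = record
      { V = Proposition ; _⊃_ = _⊃_ ; ∼ = ∼ ; Q = Q ; eq = eq ; at = always ; val = val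
      ; Designated = λ a → ∀ w → holds a w
      ; stable = λ a ¬¬f w → stable a w λ ¬a → ¬¬f λ f → ¬a (f w)
      ; _#_  = λ x a → ¬ Free a x
      ; #-⊃  = λ x∉a x∉b → [ x∉a , x∉b ]
      ; #-∼  = id
      ; #-Q  = λ _ → id
      ; #-eq = λ x≢y x≢z → [ ≢-sym x≢y , ≢-sym x≢z ]
      ; #-at = id
      }

    laws : Laws structure ｛ ALLdistr ｝
    laws = record
      { mp-law       = λ _ a a⊃b w → a⊃b w (a w)
      ; minimp-law   = λ _ _ _ _ _ _ _ _ f g b → g (λ _ → b) (f b)
      ; peirce-law   = λ _ a _ w f → stable a w λ ¬a → ¬a (f λ h → contradiction h ¬a)
      ; contrap-law  = λ _ _ _ _ f b a → f a b
      ; notelim-law  = λ _ _ _ _ ¬a a → contradiction a ¬a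
      ; gen-law      = λ _ _ a w → a w , λ _ → a
      ; ALLdistr-law = λ ¬X → contradiction refl ¬X
      ; spec-law     = λ _ _ _ _ → proj₁
      ; modal5-law   = λ _ _ _ _ ¬f → ¬f , λ x∈ _ (_ , f) → ¬f (f x∈ _ , f)
      ; vacGen-law   = λ _ x∉a _ a → a , λ x∈a → contradiction x∈a x∉a
      ; ALLcomm-law  = λ _ _ _ _ _ ((a , f) , g) →
          (a , λ x∈ w → proj₁ (g x∈ w)) , λ y∈ w → f y∈ w , λ x∈ w′ → proj₁ (g x∈ w′)
      ; EQrefl-law   = λ _ _ _ x≢x → contradiction refl x≢x
      ; EQsymm-law   = λ _ _ _ _ f → f ∘ ≢-sym
      ; EQtrans-law  = λ _ → EQtrans-law
      ; denot-law    = λ _ _ _ _ (_ , f) → f (inj₁ refl) true λ _ → tt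
      ; subst-law    = λ _ x≢y a w →
          (λ w≈ aw → subst-law x≢y a w w≈ aw) , λ _ w′ w≈ aw → subst-law x≢y a w′ w≈ aw
      ; ALLeq-law    = λ _ → ALLeq-law
      ; genEq-law    = λ _ → genEq-law
      }
      where
      open Structure structure using () renaming (Designated to ⊩)

      EQtrans-law : ∀ x y z → ⊩ (eq x y ⊃ (eq y z ⊃ eq x z))
      EQtrans-law x y z w f g x≢z with x ≟ y
      ... | yes refl = g x≢z
      ... | no x≢y   = f x≢y

      subst-law : ∀ {x y} → x ≢ y → ∀ a → ⊩ (eq x y ⊃ (a ⊃ Q x (eq x y ⊃ a)))
      subst-law x≢y a false f aw = ⊥-elim (f x≢y)
      subst-law x≢y a true  f aw = (λ _ → aw) , λ where
        _ false g → ⊥-elim (g x≢y)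
        _ true  _ → aw

      ALLeq-law : ∀ x y a → ⊩ (Q x (eq x y) ⊃ (Q x a ⊃ Q y a))
      ALLeq-law x y a w (_ , f) = case x ≟ y of λ where
        (yes refl) g → g
        (no x≢y)   _ → ⊥-elim (f (inj₁ refl) false x≢y)

      genEq-law : ∀ x y z →
        ⊩ (∼ (Q x (eq x y)) ⊃ (∼ (Q x (eq x z)) ⊃ (eq y z ⊃ Q x (eq y z))))
      genEq-law x y z w x≉y x≉z y≈z = y≈z ,
        [ (λ { refl → contradiction trivially x≉y }) , (λ { refl → contradiction trivially x≉z }) ]
        where
        trivially : holds (Q x (eq x x)) w
        trivially = (contradiction refl) , λ _ _ → contradiction refl

  unlisted : ∀ {pairs X m n} → (m , n) ∉ pairs → (n , m) ∉ pairs →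
    ¬ (⟪ (λ m n → (m , n) ∈ pairs) ⟫ ↾ X) ∋｛ m , n ｝
  unlisted mn∉ nm∉ (_ , inj₁ ((_ , d) , _)) = [ mn∉ , nm∉ ] d
  unlisted mn∉ nm∉ (_ , inj₂ ((_ , d) , _)) = [ nm∉ , mn∉ ] d

  -- Independence of the propositional schemes

  -- Every implication and every negation is designated, hence so is `φ ⇒ ψ` with `φ` true and `ψ`
  -- false.
  ¬mp : ¬ Provable (TMM ∖ ｛ mp ｝) mp
  ¬mp = unprovable structure
    (laws (λ ¬X → contradiction refl ¬X) (λ _ → from-yes minimp?) (λ _ → from-yes peirce?)
      (λ _ → from-yes contrap?) (λ _ → from-yes notelim?) (from-yes identity?) (from-yes top?))
    id (λ _ _ → tt) (tt ∷ tt ∷ []) id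
    where
    designated : Fin 2 → Bool
    designated 0F = false
    designated 1F = true

    val : fmMV → Fin 2
    val (fm 1) = 0F
    val _      = 1F

    open Matrix (λ _ _ → 1F) (λ _ → 1F) 1F designated val

  -- The classical truth tables with three true values 1, 2, 3, except that 2 ⊃ 3 is
  -- false.  Since 2 is no output, and 3 is one of 0 ⊃ b only, the other schemes do
  -- not notice; minimp yields 2 ⊃ 3 at φ = 2, ψ = 1, χ = 0.
  ¬minimp : ¬ Provable (TMM ∖ ｛ minimp ｝) minimp
  ¬minimp = unprovable structure
    (laws (λ _ → from-yes mp?) (λ ¬X → contradiction refl ¬X) (λ _ → from-yes peirce?)
      (λ _ → from-yes contrap?) (λ _ → from-yes notelim?) (from-yes identity?) (from-yes top?))
    id (λ _ _ → tt) [] id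
    where
    _⊃_ : Fin 4 → Fin 4 → Fin 4
    0F ⊃ _  = 3F
    _  ⊃ 0F = 0F
    2F ⊃ 3F = 0F
    _  ⊃ _  = 1F

    ∼ : Fin 4 → Fin 4
    ∼ 0F = 1F
    ∼ _  = 0F

    designated : Fin 4 → Bool
    designated 0F = false
    designated _  = true

    val : fmMV → Fin 4
    val (fm 0) = 2F
    val (fm 2) = 0F
    val _      = 1F

    open Matrix _⊃_ ∼ 1F designated val

  -- The three-element Gödel chain.
  ¬peirce : ¬ Provable (TMM ∖ ｛ peirce ｝) peirce
  ¬peirce = unprovable structure
    (laws (λ _ → from-yes mp?) (λ _ → from-yes minimp?) (λ ¬X → contradiction refl ¬X)
      (λ _ → from-yes contrap?) (λ _ → from-yes notelim?) (from-yes identity?) (from-yes top?))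
    id (λ _ _ → tt) [] id
    where
    _⊃_ : Fin 3 → Fin 3 → Fin 3
    0F ⊃ _  = 2F
    1F ⊃ 0F = 0F
    1F ⊃ _  = 2F
    2F ⊃ b  = b

    ∼ : Fin 3 → Fin 3
    ∼ a = a ⊃ 0F

    designated : Fin 3 → Bool
    designated 2F = true
    designated _  = false

    val : fmMV → Fin 3
    val (fm 0) = 1F
    val _      = 0F

    open Matrix _⊃_ ∼ 2F designated val

  -- Classical implication with a second false value 1 whose negation is false too.
  ¬contrap : ¬ Provable (TMM ∖ ｛ contrap ｝) contrap
  ¬contrap = unprovable structure
    (laws (λ _ → from-yes mp?) (λ _ → from-yes minimp?) (λ _ → from-yes peirce?)
      (λ ¬X → contradiction refl ¬X) (λ _ → from-yes notelim?) (from-yes identity?) (from-yes top?))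
    id (λ _ _ → tt) [] id
    where
    _⊃_ : Fin 3 → Fin 3 → Fin 3
    2F ⊃ b = b
    _  ⊃ _ = 2F

    ∼ : Fin 3 → Fin 3
    ∼ 0F = 2F
    ∼ _  = 0F

    designated : Fin 3 → Bool
    designated 2F = true
    designated _  = false

    val : fmMV → Fin 3
    val (fm 0) = 1F
    val _      = 2F

    open Matrix _⊃_ ∼ 2F designated val

  -- Implication is classical and negation constantly true. Then contrap survives because its
  -- consequent ends in a negation.
  ¬notelim : ¬ Provable (TMM ∖ ｛ notelim ｝) notelim
  ¬notelim = unprovable structure
    (laws (λ _ → from-yes mp?) (λ _ → from-yes minimp?) (λ _ → from-yes peirce?)
      (λ _ → from-yes contrap?) (λ ¬X → contradiction refl ¬X) (from-yes identity?) (from-yes top?))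
    id (λ _ _ → tt) [] id
    where
    _⊃_ : Fin 2 → Fin 2 → Fin 2
    1F ⊃ b = b
    0F ⊃ _ = 1F

    designated : Fin 2 → Bool
    designated 0F = false
    designated 1F = true

    val : fmMV → Fin 2
    val (fm 0) = 1F
    val _      = 0F

    open Matrix _⊃_ (λ _ → 1F) 1F designated val

  -- Independence of the quantifier schemes and subst

  ¬ALLdistr : ¬ Provable (TMM ∖ ｛ ALLdistr ｝) ALLdistr
  ¬ALLdistr = unprovable structure laws id (λ _ → fresh) [] λ h →
    proj₂ (h true ((λ _ → tt) , λ _ _ → id) (tt , ⊥-elim)) refl false
    where
    open Tracked
    open Structure structure using (_#_)

    fresh : ∀ {u p} → Separated ALLdistr u p → u # val p
    fresh {p = fm 0}             _        ()
    fresh {p = fm (suc (suc _))} _        ()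
    fresh {p = fm 1}             (inj₁ d) refl = unlisted (λ ()) (λ ()) d
    fresh {p = fm 1}             (inj₂ f) refl = f (here refl , there (there (here refl)))

  totalFrame rigidFrame : (D : Set) (_≈_ : Rel D 0ℓ) → (∀ a b → Stable (a ≈ b)) → Frame
  totalFrame D _≈_ ≈-stable = record { D = D ; _R_ = λ _ _ → ⊤ ; _≈_ = _≈_ ; ≈-stable = ≈-stable }
  rigidFrame D _≈_ ≈-stable =
    record { D = D ; _R_ = _≡_ ; R-refl = refl ; _≈_ = _≈_ ; ≈-stable = ≈-stable }

  -- A variable cannot leave its present value, so denot holds only if every value is `≈` to each
  -- self-equal one.
  rigid-admissible : ∀ {D _≈_ ≈-stable X} →
    (¬ X EQrefl → Reflexive _≈_) → (¬ X EQsymm → Symmetric _≈_) → (¬ X EQtrans → Transitive _≈_) →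
    (¬ X denot → ∀ {a} → a ≈ a → ∀ b → b ≈ a) →
    Frame.Admissible (rigidFrame D _≈_ ≈-stable) X
  rigid-admissible ≈-refl ≈-sym ≈-trans denoting = record
    { R-euclidean = λ { _ refl refl → refl }
    ; ≈-refl  = ≈-refl
    ; ≈-sym   = ≈-sym
    ; ≈-trans = ≈-trans
    ; denoting  = λ ¬X a≈a b → b , refl , denoting ¬X a≈a b
    ; injective = λ _ _ _ r → r
    ; trivial-or-escaping = inj₁ id
    }

  -- Ordinary first-order semantics; the second element of the domain is what lets `x` escape
  -- equality with `y`.
  boolFrame : Frame
  boolFrame = totalFrame Bool _≡_ (λ a b → decidable-stable (a Bool.≟ b))

  bool-admissible : ∀ {X} → Frame.Admissible boolFrame X
  bool-admissible = record
    { R-euclidean = λ _ _ _ → tt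
    ; ≈-refl  = λ _ → refl
    ; ≈-sym   = λ _ → sym
    ; ≈-trans = λ _ → trans
    ; denoting  = λ _ {a} _ _ → a , tt , refl
    ; injective = λ { _ refl refl _ → refl }
    ; trivial-or-escaping = inj₂ (refl , λ _ a _ → not a , tt , Bool.not-¬ refl ∘ sym)
    }

  -- At the single actual assignment `φ` is true, but the quantifier also visits the value `false`,
  -- where it is not. The other laws hold pointwise at each assignment.
  ¬gen : ¬ Provable (TMM ∖ ｛ gen ｝) gen
  ¬gen = unprovable structure (laws bool-admissible (λ ¬X → contradiction refl ¬X)) id
    (λ _ {_} {q} sep → #-val q (inj₂ (fresh sep))) ((λ { _ refl → tt }) ∷ [])
    (λ h → h _ refl {false} tt)
    where
    open Kripke boolFrame T (λ a → decidable-stable (T? a)) ｛ const true ｝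

    fresh : ∀ {u q} → Separated gen u q → u ≡ vr 0 → q ≢ fm 0
    fresh (inj₁ d) refl refl = unlisted (λ ()) (λ ()) d
    fresh (inj₂ f) refl refl = f (there (here refl) , here refl)

  -- With vacGen waived, `φ` may depend on `x` in spite of the condition separating the two.
  ¬vacGen : ¬ Provable (TMM ∖ ｛ vacGen ｝) vacGen
  ¬vacGen = unprovable structure (laws bool-admissible (λ _ _ → tt)) id
    (λ ¬X → contradiction refl ¬X) [] (λ h → h (const true) tt tt {false} tt)
    where open Kripke boolFrame T (λ a → decidable-stable (T? a)) (λ _ → ⊤)

  -- Equality sees the first coordinate and `φ` the second, so equal values of `x` can disagree on
  -- `φ`.
  ¬subst : ¬ Provable (TMM ∖ ｛ subst ｝) subst
  ¬subst = unprovable structure (laws admissible (λ _ _ → tt)) id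
    (λ _ {_} {q} sep → #-val q (inj₂ (fresh sep))) []
    (λ h → h (const (true , true)) tt {true , true} tt refl tt {true , false} tt refl)
    where
    frame : Frame
    frame = totalFrame (Bool × Bool) (λ a b → proj₁ a ≡ proj₁ b)
      (λ a b → decidable-stable (proj₁ a Bool.≟ proj₁ b))

    admissible : Frame.Admissible frame ｛ subst ｝
    admissible = record
      { R-euclidean = λ _ _ _ → tt
      ; ≈-refl  = λ _ → refl
      ; ≈-sym   = λ _ → sym
      ; ≈-trans = λ _ → trans
      ; denoting  = λ _ {a} _ _ → a , tt , refl
      ; injective = λ ¬X → contradiction refl ¬X
      ; trivial-or-escaping =
          inj₂ (refl , λ _ (a , _) _ → (not a , true) , tt , Bool.not-¬ refl ∘ sym)
      }

    open Kripke frame (T ∘ proj₂) (λ a → decidable-stable (T? (proj₂ a))) (λ _ → ⊤)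

    fresh : ∀ {u q} → Separated subst u q → u ≡ vr 0 → q ≢ fm 0
    fresh (inj₁ d) refl refl =
      unlisted (λ { (there (there ())) }) (λ { (there (there ())) }) d
    fresh (inj₂ f) refl refl = f (here refl , there (there (there (here refl))))

  ¬modal5 : ¬ Provable (TMM ∖ ｛ modal5 ｝) modal5
  ¬modal5 = unprovable structure (laws admissible (λ _ _ → tt)) id
    (λ _ {_} {q} sep → #-val q (inj₂ (fresh sep))) []
    -- `φ` fails only at `(false , false)`. Its successor `(true , false)` sees only itself and
    -- `(false , true)`, so `all x φ` holds there.
    (λ h → h (const (false , false)) tt (λ f → f (inj₁ refl))
       {true , false} (inj₂ refl) λ { (inj₁ refl) → tt ; (inj₂ refl) → tt })
    where
    -- A 4-cycle alternating between the two ≈-classes, so that every point sees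
    -- exactly one point of each class: denot and subst survive without modal5.
    next : Bool × Bool → Bool × Bool
    next (a , b) = not a , (if a then not b else b)

    frame : Frame
    frame = record
      { D = Bool × Bool
      ; _R_ = λ a b → b ≡ a ⊎ b ≡ next a
      ; R-refl = inj₁ refl
      ; _≈_ = λ a b → proj₁ a ≡ proj₁ b
      ; ≈-stable = λ a b → decidable-stable (proj₁ a Bool.≟ proj₁ b)
      }

    admissible : Frame.Admissible frame ｛ modal5 ｝
    admissible = record
      { R-euclidean = λ ¬X → contradiction refl ¬X
      ; ≈-refl  = λ _ → refl
      ; ≈-sym   = λ _ → sym
      ; ≈-trans = λ _ → trans
      ; denoting  = λ _ {a} _ b → denoting a b
      ; injective = λ
          { _ _ _ (inj₁ refl) → refl
          ; _ b≈a c≈a (inj₂ refl) → contradiction (trans b≈a (sym c≈a)) (Bool.not-¬ refl)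
          }
      ; trivial-or-escaping = inj₂ (refl , λ _ → escaping)
      }
      where
      open Frame frame using (_R_; _≈_)

      denoting : ∀ a b → ∃[ c ] (b R c × c ≈ a)
      denoting (a , _) b with proj₁ b Bool.≟ a
      ... | yes b≡a = b , inj₁ refl , b≡a
      ... | no b≢a  = next b , inj₂ refl , sym (Bool.¬-not (b≢a ∘ sym))

      escaping : ∀ a b → ∃[ c ] (b R c × ¬ c ≈ a)
      escaping a b with proj₁ b Bool.≟ proj₁ a
      ... | yes b≡a = next b , inj₂ refl , λ nb≡a → Bool.not-¬ (sym b≡a) (sym nb≡a)
      ... | no b≢a  = b , inj₁ refl , b≢a

    open Kripke frame (λ (a , b) → T (a ∨ b)) (λ (a , b) → decidable-stable (T? (a ∨ b))) (λ _ → ⊤)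

    fresh : ∀ {u q} → Separated modal5 u q → u ≡ vr 0 → q ≢ fm 0
    fresh (inj₁ d) refl refl = unlisted (λ ()) (λ ()) d
    fresh (inj₂ f) refl refl = f (here refl , there (here refl))

  -- Independence of the equality schemes and denot

  -- As an assignment this gives `x`, `y`, `z` the values 0, 1, 2, and it refutes every scheme
  -- below.
  index : vrMV → ℕ
  index (vr n) = n

  unconstrained : ∀ {A : Set} → A → Stable ⊤
  unconstrained _ _ = tt

  -- When nothing equals anything, EQsymm, EQtrans and denot hold vacuously.
  ¬EQrefl : ¬ Provable (TMM ∖ ｛ EQrefl ｝) EQrefl
  ¬EQrefl = unprovable structure
    (laws (rigid-admissible (λ ¬X → contradiction refl ¬X) (λ _ ()) (λ _ ()) (λ _ ())) (λ _ _ → tt)) id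
    (λ _ {_} {q} _ → #-val q (inj₁ _)) [] (λ h → h index tt)
    where open Kripke (rigidFrame ℕ (λ _ _ → ⊥) (λ _ _ ¬¬⊥ → ¬¬⊥ id)) (λ _ → ⊤) unconstrained (λ _ → ⊤)

  -- Under genuine equality `y`, stuck at 1, can never reach the value 0 of `x`.
  ¬denot : ¬ Provable (TMM ∖ ｛ denot ｝) denot
  ¬denot = unprovable structure
    (laws (rigid-admissible (λ _ → refl) (λ _ → sym) (λ _ → trans) (λ ¬X → contradiction refl ¬X))
       (λ _ _ → tt)) id
    (λ _ {_} {q} _ → #-val q (inj₁ _)) [] (λ h → h index tt refl λ { refl () })
    where
    open Kripke (rigidFrame ℕ _≡_ (λ a b → decidable-stable (a ℕ.≟ b)))
      (λ _ → ⊤) unconstrained (λ _ → ⊤)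

  ≤-stable : ∀ a b → Stable (a ℕ.≤ b)
  ≤-stable a b = decidable-stable (a ℕ.≤? b)

  -- Reflexive and symmetric, but not transitive along 0, 1, 2.
  Near : Rel ℕ 0ℓ
  Near a b = ∣ a - b ∣ ℕ.≤ 1

  Near-stable : ∀ a b → Stable (Near a b)
  Near-stable a b = ≤-stable ∣ a - b ∣ 1

  Near-refl : Reflexive Near
  Near-refl {a} = ≡.subst (ℕ._≤ 1) (sym (ℕ.∣n-n∣≡0 a)) z≤n

  Near-sym : Symmetric Near
  Near-sym {a} {b} = ≡.subst (ℕ._≤ 1) (ℕ.∣-∣-comm a b)

  -- Under full quantification, reflexivity of `≤` already yields denot and genEq, and 0 ≤ 1 has no
  -- converse.
  ¬EQsymm-without-subst-ALLeq :
    ¬ Provable ((TMM ∖ (｛ subst ｝ ∪ ｛ ALLeq ｝)) ∖ ｛ EQsymm ｝) EQsymm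
  ¬EQsymm-without-subst-ALLeq = unprovable-without structure (laws admissible (λ _ _ → tt))
    (λ {_} {q} _ → #-val q (inj₁ _)) [] (λ h → contradiction (h index tt z≤n) λ ())
    where
    frame : Frame
    frame = totalFrame ℕ ℕ._≤_ ≤-stable

    admissible : Frame.Admissible frame ((｛ subst ｝ ∪ ｛ ALLeq ｝) ∪ ｛ EQsymm ｝)
    admissible = record
      { R-euclidean = λ _ _ _ → tt
      ; ≈-refl  = λ _ → ℕ.≤-refl
      ; ≈-sym   = λ ¬X → contradiction (inj₂ refl) ¬X
      ; ≈-trans = λ _ → ℕ.≤-trans
      ; denoting  = λ _ {a} a≤a _ → a , tt , a≤a
      ; injective = λ ¬X → contradiction (inj₁ (inj₁ refl)) ¬X
      ; trivial-or-escaping = inj₂ (ℕ.≤-refl , λ ¬X → contradiction (inj₁ (inj₂ refl)) ¬X)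
      }

    open Kripke frame (λ _ → ⊤) unconstrained (λ _ → ⊤)

  ¬EQtrans-without-subst-ALLeq :
    ¬ Provable ((TMM ∖ (｛ subst ｝ ∪ ｛ ALLeq ｝)) ∖ ｛ EQtrans ｝) EQtrans
  ¬EQtrans-without-subst-ALLeq = unprovable-without structure (laws admissible (λ _ _ → tt))
    (λ {_} {q} _ → #-val q (inj₁ _)) [] (λ h → contradiction (h index tt (s≤s z≤n) (s≤s z≤n)) λ { (s≤s ()) })
    where
    frame : Frame
    frame = totalFrame ℕ Near Near-stable

    admissible : Frame.Admissible frame ((｛ subst ｝ ∪ ｛ ALLeq ｝) ∪ ｛ EQtrans ｝)
    admissible = record
      { R-euclidean = λ _ _ _ → tt
      ; ≈-refl  = λ _ {a} → Near-refl {a}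
      ; ≈-sym   = λ _ {a} {b} → Near-sym {a} {b}
      ; ≈-trans = λ ¬X → contradiction (inj₂ refl) ¬X
      ; denoting  = λ _ {a} a≈a _ → a , tt , a≈a
      ; injective = λ ¬X → contradiction (inj₁ (inj₁ refl)) ¬X
      ; trivial-or-escaping =
          inj₂ ((λ {a} → Near-refl {a}) , λ ¬X → contradiction (inj₁ (inj₂ refl)) ¬X)
      }

    open Kripke frame (λ _ → ⊤) unconstrained (λ _ → ⊤)

  -- Vacuous quantifiers validate subst, ALLeq and genEq whatever `≈` is, which leaves room for `≤`.
  ¬EQsymm-without-denot : ¬ Provable ((TMM ∖ ｛ denot ｝) ∖ ｛ EQsymm ｝) EQsymm
  ¬EQsymm-without-denot = unprovable-without structure
    (laws (rigid-admissible (λ _ → ℕ.≤-refl) (λ ¬X → contradiction (inj₂ refl) ¬X)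
       (λ _ → ℕ.≤-trans) (λ ¬X → contradiction (inj₁ refl) ¬X)) (λ _ _ → tt))
    (λ {_} {q} _ → #-val q (inj₁ _)) [] (λ h → contradiction (h index tt z≤n) λ ())
    where
    open Kripke (rigidFrame ℕ ℕ._≤_ ≤-stable) (λ _ → ⊤) unconstrained (λ _ → ⊤)

  ¬EQtrans-without-denot : ¬ Provable ((TMM ∖ ｛ denot ｝) ∖ ｛ EQtrans ｝) EQtrans
  ¬EQtrans-without-denot = unprovable-without structure
    (laws (rigid-admissible (λ _ {a} → Near-refl {a}) (λ _ {a} {b} → Near-sym {a} {b})
       (λ ¬X → contradiction (inj₂ refl) ¬X) (λ ¬X → contradiction (inj₁ refl) ¬X)) (λ _ _ → tt))
    (λ {_} {q} _ → #-val q (inj₁ _)) [] (λ h → contradiction (h index tt (s≤s z≤n) (s≤s z≤n)) λ { (s≤s ()) })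
    where
    open Kripke (rigidFrame ℕ Near Near-stable) (λ _ → ⊤) unconstrained (λ _ → ⊤)

mainTheorem1 : (𝓛 : Language) → let open Metalogic 𝓛 in
    All (IndependentIn TMM)
    ( mp ∷ minimp ∷ peirce ∷ contrap ∷ notelim ∷ gen ∷ ALLdistr
    ∷ vacGen ∷ EQrefl ∷ denot ∷ subst ∷ modal5 ∷ [] )
    × All (λ Φ → IndependentIn (TMM ∖ (｛ subst ｝ ∪ ｛ ALLeq ｝)) Φ
    × IndependentIn (TMM ∖ ｛ denot ｝) Φ)
    ( EQsymm ∷ EQtrans ∷ [] )
mainTheorem1 𝓛 =
    -- The numerals are positions in the list defining `TMM`, whose order differs from the one here.
    ( (∈-lookup 0F , ¬mp 𝓛)
    ∷ (∈-lookup 1F , ¬minimp 𝓛)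
    ∷ (∈-lookup 2F , ¬peirce 𝓛)
    ∷ (∈-lookup 3F , ¬contrap 𝓛)
    ∷ (∈-lookup 4F , ¬notelim 𝓛)
    ∷ (∈-lookup 5F , ¬gen 𝓛)
    ∷ (∈-lookup 6F , ¬ALLdistr 𝓛)
    ∷ (∈-lookup 9F , ¬vacGen 𝓛)
    ∷ (∈-lookup (# 11) , ¬EQrefl 𝓛)
    ∷ (∈-lookup (# 14) , ¬denot 𝓛)
    ∷ (∈-lookup (# 15) , ¬subst 𝓛)
    ∷ (∈-lookup 8F , ¬modal5 𝓛)
    ∷ [] )
  , ( ( ((∈-lookup (# 12) , [ (λ ()) , (λ ()) ]) , ¬EQsymm-without-subst-ALLeq 𝓛)
      , ((∈-lookup (# 12) , λ ()) , ¬EQsymm-without-denot 𝓛) )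
    ∷ ( ((∈-lookup (# 13) , [ (λ ()) , (λ ()) ]) , ¬EQtrans-without-subst-ALLeq 𝓛)
      , ((∈-lookup (# 13) , λ ()) , ¬EQtrans-without-denot 𝓛) )
    ∷ [] )
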